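{- Define a sequence $(\mathbf{D}^{(i)})_{i\ge 0}$ of $2\times2$ integer matrices by $\mathbf{D}^{(0)}=\mathbf{I}$ (the identity matrix) and, writing $\mathbf{D}^{(i)}=\begin{pmatrix}D_{00}&D_{01}\\ D_{10}&D_{11}\end{pmatrix}$, $$\mathbf{D}^{(i+1)}=\begin{cases}\begin{pmatrix}1&0\\ D_{01}+D_{11}&1\end{pmatrix}&\text{if } D_{00}+D_{10}=1,\\[3mm] \mathbf{D}^{(i)}\begin{pmatrix}2j+1&1\\ -1&0\end{pmatrix},\ \ j=\left\lfloor\dfrac{D_{01}+D_{11}-1}{D_{00}+D_{10}}\right\rfloor,&\text{if } D_{00}+D_{10}\neq1.\end{cases}$$ Then the sequence is well defined and for every $i\ge0$, $\mathbf{D}^{(i)}=\mu(s_i)$, where $s_0,s_1,s_2,\dots$ is the list of all finite strings over $\{\mathrm{L},\mathrm{R}\}$ in level order; that is, the sequence enumerates the tree of products of $\mathbf{L}$ and $\mathbf{R}$ level by level and from left to right within each level. Consequently: (a) the sequence of rationals $\frac{p_i}{q_i}$ with $\begin{pmatrix}p_i\\ q_i\end{pmatrix}=\mathbf{D}^{(i)}\begin{pmatrix}1\\ 1\end{pmatrix}$ enumerates every positive rational exactly once, in lowest form, in the level-by-level, left-to-right order of the Stern-Brocot tree; (b) the sequence of rationals $\frac{n_i}{m_i}$ with $(m_i\ \ n_i)=(1\ \ 1)\,\mathbf{D}^{(i)}$ enumerates every positive rational exactly once, in lowest form, in the level-by-level, left-to-right order of the Eisenstein-Stern (Calkin-Wilf)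 tree.
   Context: Let $\mathbf{L}=\begin{pmatrix}1&0\\ 1&1\end{pmatrix}$ and $\mathbf{R}=\begin{pmatrix}1&1\\ 0&1\end{pmatrix}$. Let $\mu$ be the monoid homomorphism from finite strings over $\{\mathrm{L},\mathrm{R}\}$ (under concatenation) to $2\times2$ integer matrices (under multiplication) with $\mu(\mathrm{L})=\mathbf{L}$, $\mu(\mathrm{R})=\mathbf{R}$; the empty string is mapped to $\mathbf{I}$. Level order on strings: shorter strings come first, and strings of equal length are ordered lexicographically with $\mathrm{L}<\mathrm{R}$. The tree of products is the infinite binary tree whose root is $\mathbf{I}$ and in which the node reached from the root by the string $s$ of left (L) and right (R) branches is $\mu(s)$; so a node $\mathbf{D}$ has left child $\mathbf{D}\mathbf{L}$ and right child $\mathbf{D}\mathbf{R}$. The Stern-Brocot tree is obtained by replacing each node $\mathbf{D}$ by the rational $\frac{x}{y}$ with $\begin{pmatrix}x\\ y\end{pmatrix}=\mathbf{D}\begin{pmatrix}1\\ 1\end{pmatrix}$. The Eisenstein-Stern tree (also known as the Calkin-Wilf tree) is obtained by replacing each node $\mathbf{D}$ by the rational $\frac{y}{x}$ with $(x\ \ y)=(1\ \ 1)\,\mathbf{D}$. -}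

module Defs where

open import Data.Bool.Base using (if_then_else_)
open import Data.Integer.Base using (ℤ; +_; -[1+_]; 0ℤ; 1ℤ; -1ℤ; _+_; _*_; _-_; -_; _<_)
open import Data.Integer.Coprimality using (Coprime)
open import Data.Integer.Properties using (_≟_)
open import Data.List.Base using (List; []; _∷_; length)
open import Data.List.Relation.Binary.Lex.Strict using (Lex-<)
open import Data.Maybe.Base using (Maybe; just; nothing; map; _>>=_)
import Data.Nat.Base as ℕ
open import Data.Nat.Base using (ℕ; zero; suc)
open import Data.Product using (_×_; ∃!)
open import Data.Rational.Base as ℚ using (ℚ; 0ℚ; floor)
open import Data.Sum.Base using (_⊎_)
open import Function.Definitions using (StrictlySurjective)
open import Relation.Binary.PropositionalEquality.Core using (_≡_)
open import Relation.Nullary.Decidable.Core using (does)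

record Matrix : Set where
  constructor mat
  field
    e₀₀ e₀₁ e₁₀ e₁₁ : ℤ

record Vec₂ : Set where
  constructor vec
  field
    x y : ℤ

infixl 7 _⊗_ _⊗ᶜ_ _ʳ⊗_

_⊗_ : Matrix → Matrix → Matrix
mat a b c d ⊗ mat a′ b′ c′ d′ =
  mat (a * a′ + b * c′) (a * b′ + b * d′)
      (c * a′ + d * c′) (c * b′ + d * d′)

-- The vector is a column here, and a row in _ʳ⊗_.
_⊗ᶜ_ : Matrix → Vec₂ → Vec₂
mat a b c d ⊗ᶜ vec x y = vec (a * x + b * y) (c * x + d * y)

_ʳ⊗_ : Vec₂ → Matrix → Vec₂
vec x y ʳ⊗ mat a b c d = vec (x * a + y * c) (x * b + y * d)

𝐈 𝐋 𝐑 : Matrix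
𝐈 = mat 1ℤ 0ℤ 0ℤ 1ℤ
𝐋 = mat 1ℤ 0ℤ 1ℤ 1ℤ
𝐑 = mat 1ℤ 1ℤ 0ℤ 1ℤ

𝟏 : Vec₂
𝟏 = vec 1ℤ 1ℤ

data Letter : Set where
  L R : Letter

data _<ᴸ_ : Letter → Letter → Set where
  L<R : L <ᴸ R

String : Set
String = List Letter

generator : Letter → Matrix
generator L = 𝐋
generator R = 𝐑

μ : String → Matrix
μ []      = 𝐈
μ (a ∷ w) = generator a ⊗ μ w

_<ˡᵉᵛ_ : String → String → Set
v <ˡᵉᵛ w = length v ℕ.< length w
         ⊎ (length v ≡ length w × Lex-< _≡_ _<ᴸ_ v w)

-- These two conditions determine s uniquely: it is the order isomorphism
-- from ℕ onto all strings in level order.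
record IsLevelOrderList (s : ℕ → String) : Set where
  field
    increasing : ∀ {i j} → i ℕ.< j → s i <ˡᵉᵛ s j
    exhaustive : StrictlySurjective _≡_ s

-- The quotient of two integers as a rational number, undefined for
-- denominator zero.
_÷_ : ℤ → ℤ → Maybe ℚ
n ÷ (+ zero)  = nothing
n ÷ (+ suc d) = just (n ℚ./ suc d)
n ÷ -[1+ d ]  = just ((- n) ℚ./ suc d)

next : Matrix → Maybe Matrix
next D@(mat D₀₀ D₀₁ D₁₀ D₁₁) =
  if does (D₀₀ + D₁₀ ≟ 1ℤ)
  then just (mat 1ℤ 0ℤ (D₀₁ + D₁₁) 1ℤ)
  else map (λ x → D ⊗ mat (+ 2 * floor x + 1ℤ) 1ℤ -1ℤ 0ℤ)
           ((D₀₁ + D₁₁ - 1ℤ) ÷ (D₀₀ + D₁₀))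

-- The i-th term of the recursively defined sequence; `nothing` as soon as the
-- recursion divides by zero, so that well-definedness is a genuine claim.
matrixSeq : ℕ → Maybe Matrix
matrixSeq zero    = just 𝐈
matrixSeq (suc i) = matrixSeq i >>= next

-- An infinite binary tree, given by the label of the node reached from the root
-- by each string of left and right branches.
Tree : Set → Set
Tree A = String → A

mapTree : {A B : Set} → (A → B) → Tree A → Tree B
mapTree f t w = f (t w)

treeOfProducts : Tree Matrix
treeOfProducts = μ

sternBrocot : Tree (Maybe ℚ)
sternBrocot = mapTree (λ D → Vec₂.x (D ⊗ᶜ 𝟏) ÷ Vec₂.y (D ⊗ᶜ 𝟏)) treeOfProducts

eisensteinStern : Tree (Maybe ℚ)
eisensteinStern = mapTree (λ D → Vec₂.y (𝟏 ʳ⊗ D) ÷ Vec₂.x (𝟏 ʳ⊗ D)) treeOfProducts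

-- The fractions num i / den i are in lowest form, run exactly once through the
-- positive rationals, and visit the nodes of the tree t in the order s.
record EnumeratesPositiveRationals
  (s : ℕ → String) (t : Tree (Maybe ℚ)) (num den : ℕ → ℤ) : Set where
  field
    value       : ℕ → ℚ
    isQuotient  : ∀ i → num i ÷ den i ≡ just (value i)
    den-pos     : ∀ i → 0ℤ < den i
    coprime     : ∀ i → Coprime (num i) (den i)
    positive    : ∀ i → 0ℚ ℚ.< value i
    exactlyOnce : ∀ x → 0ℚ ℚ.< x → ∃! _≡_ (λ i → value i ≡ x)
    treeOrder   : ∀ i → t (s i) ≡ just (value i)

{-# OPTIONS --safe #-}

-- The row sums (p q) = (1 1)D of a node are positive and can be carried along a
-- string from the left.  Within a level, the successor of v L Rᵏ is v R Lᵏ, and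
-- (L Rᵏ)⁻¹ R Lᵏ is the matrix with rows (2k+1 1) and (−1 0).  If (p q) are the
-- row sums of v, then those of v L Rᵏ are (p+q, k(p+q)+q), and 0 ≤ q−1 < p+q, so
-- the floor in the recursion recovers k.  For Rᵏ, the last node of a level, the
-- first sum is 1, and the recursion produces Lᵏ⁺¹.
-- On fractions, prefixing L or R is a step of the subtractive Euclidean
-- algorithm, so strings correspond to coprime pairs; the Eisenstein–Stern label
-- of a string is the Stern–Brocot label of its reversal.
module Submission where

open import Defs
open import Data.Integer.Base using (+_; 0ℤ; 1ℤ; -1ℤ; _+_; _*_; _<_; +<+)
import Data.Integer.Coprimality as ℤCoprimality
import Data.Integer.Properties as ℤ
open import Data.Integer.Tactic.RingSolver using (solve-∀)
open import Data.List.Base using ([]; _∷_; _++_; length; replicate; reverse)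
open import Data.List.Properties
  using (length-replicate; reverse-injective; reverse-involutive; unfold-reverse)
open import Data.List.Relation.Binary.Lex.Strict
  using (Lex-<; this; <-irreflexive; <-transitive) renaming (next to next-≡)
open import Data.List.Relation.Binary.Pointwise using (≡⇒Pointwise-≡)
open import Data.Maybe.Base using (just; _>>=_)
open import Data.Nat.Base as ℕ using (ℕ; zero; suc; NonZero; s≤s; z<s)
open import Data.Nat.Coprimality as Coprimality using (Coprime; 1-coprimeTo; coprime-+)
open import Data.Nat.Divisibility using (divides-refl; ∣-refl; ∣m∣n⇒∣m+n)
open import Data.Nat.DivMod
  using (+-distrib-/-∣ʳ; /-congˡ; /-congʳ; m*n/n≡m; m<n⇒m/n≡0; m*[n/m]≡n; m*n/m*o≡n/o)
open import Data.Nat.GCD using (gcd; gcd[m,n]≢0; gcd[m,n]∣m; gcd[m,n]∣n; n/gcd[m,n]≢0)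
open import Data.Nat.Induction using (<-wellFounded)
import Data.Nat.Properties as ℕ
open import Data.Product using (Σ-syntax; ∃-syntax; ∃!; _×_; _,_)
open import Data.Rational.Base as ℚ using (ℚ; mkℚ; mkℚ+; 0ℚ; floor; ↥_; ↧ₙ_)
import Data.Rational.Properties as ℚ
open import Data.Sum.Base using (inj₁; inj₂)
open import Function.Definitions using (Injective; StrictlySurjective)
open import Induction.WellFounded using (Acc; acc)
open import Relation.Binary.Construct.Closure.ReflexiveTransitive
  using (Star; ε; _◅_; _◅◅_; gmap)
open import Relation.Binary.Definitions using (tri<; tri≈; tri>)
open import Relation.Binary.PropositionalEquality
  using (_≡_; _≢_; refl; sym; trans; cong; cong₂; subst; resp₂; isEquivalence; module ≡-Reasoning)
open import Relation.Nullary.Negation using (¬_; contradiction)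

-- Level order

infix 4 _⋖_

-- Binary increment without overflow, L and R being the digits 0 and 1. Recursing from the front
-- lets proofs peel off the common prefix.
data _⋖_ : String → String → Set where
  carry : ∀ n → L ∷ replicate n R ⋖ R ∷ replicate n L
  keep  : ∀ {a v w} → v ⋖ w → a ∷ v ⋖ a ∷ w

data SuccessorView : String → Set where
  lastOfLevel : ∀ n → SuccessorView (replicate n R)
  sameLevel   : ∀ {v w} → v ⋖ w → SuccessorView v

target : ∀ {v} → SuccessorView v → String
target (lastOfLevel n)       = replicate (suc n) L
target (sameLevel {w = w} _) = w

view : ∀ v → SuccessorView v
view []      = lastOfLevel 0
view (a ∷ v) with a | view v
-- The head letter matters only if the tail overflows: L absorbs the carry, R passes it on.
... | a | sameLevel v⋖w = sameLevel (keep v⋖w)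
... | L | lastOfLevel n = sameLevel (carry n)
... | R | lastOfLevel n = lastOfLevel (suc n)

successor : String → String
successor v = target (view v)

view-last : ∀ n → view (replicate n R) ≡ lastOfLevel n
view-last zero    = refl
view-last (suc n) rewrite view-last n = refl

-- Makes every `⋖` step a step of `successor`, so that a chain of such steps can be followed along
-- `levelOrder`.
view-⋖ : ∀ {v w} (v⋖w : v ⋖ w) → view v ≡ sameLevel v⋖w
view-⋖ (carry n)  rewrite view-last n = refl
view-⋖ (keep v⋖w) rewrite view-⋖ v⋖w = refl

levelOrder : ℕ → String
levelOrder zero    = []
levelOrder (suc i) = successor (levelOrder i)

⋖⇒length≡ : ∀ {v w} → v ⋖ w → length v ≡ length w
⋖⇒length≡ (carry n)  = cong suc (trans (length-replicate n) (sym (length-replicate n)))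
⋖⇒length≡ (keep v⋖w) = cong suc (⋖⇒length≡ v⋖w)

⋖⇒Lex : ∀ {v w} → v ⋖ w → Lex-< _≡_ _<ᴸ_ v w
⋖⇒Lex (carry n)  = this L<R
⋖⇒Lex (keep v⋖w) = next-≡ refl (⋖⇒Lex v⋖w)

<ˡᵉᵛ-trans : ∀ {u v w} → u <ˡᵉᵛ v → v <ˡᵉᵛ w → u <ˡᵉᵛ w
<ˡᵉᵛ-trans (inj₁ p)       (inj₁ q)       = inj₁ (ℕ.<-trans p q)
<ˡᵉᵛ-trans (inj₁ p)       (inj₂ (e , _)) = inj₁ (subst (_ ℕ.<_) e p)
<ˡᵉᵛ-trans (inj₂ (e , _)) (inj₁ q)       = inj₁ (subst (ℕ._< _) (sym e) q)
<ˡᵉᵛ-trans (inj₂ (e , p)) (inj₂ (f , q)) =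
  inj₂ (trans e f , <-transitive isEquivalence (resp₂ _<ᴸ_) (λ { L<R () }) p q)

<ˡᵉᵛ-irrefl : ∀ {v} → ¬ v <ˡᵉᵛ v
<ˡᵉᵛ-irrefl (inj₁ p)       = ℕ.<-irrefl refl p
<ˡᵉᵛ-irrefl (inj₂ (_ , p)) = <-irreflexive (λ { refl () }) (≡⇒Pointwise-≡ refl) p

<ˡᵉᵛ-successor : ∀ v → v <ˡᵉᵛ successor v
<ˡᵉᵛ-successor v with view v
... | sameLevel v⋖w = inj₂ (⋖⇒length≡ v⋖w , ⋖⇒Lex v⋖w)
... | lastOfLevel n
  rewrite length-replicate n {x = R} | length-replicate n {x = L} = inj₁ (ℕ.n<1+n n)

levelOrder-increasing : ∀ {i j} → i ℕ.< j → levelOrder i <ˡᵉᵛ levelOrder j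
levelOrder-increasing {i} {suc j} (s≤s i≤j) with ℕ.m≤n⇒m<n∨m≡n i≤j
... | inj₁ i<j  = <ˡᵉᵛ-trans (levelOrder-increasing i<j) (<ˡᵉᵛ-successor (levelOrder j))
... | inj₂ refl = <ˡᵉᵛ-successor (levelOrder i)

-- A level consists of its L-half followed by its R-half. To enter the R-half, the chain runs
-- through the whole L-half up to L Rⁿ and takes one `carry` to R Lⁿ.
firstOfLevel⋖⋆ : ∀ n w → length w ≡ n → Star _⋖_ (replicate n L) w
firstOfLevel⋖⋆ zero    []      _ = ε
firstOfLevel⋖⋆ (suc n) (L ∷ w) e = gmap (L ∷_) keep (firstOfLevel⋖⋆ n w (ℕ.suc-injective e))
firstOfLevel⋖⋆ (suc n) (R ∷ w) e =
  gmap (L ∷_) keep (firstOfLevel⋖⋆ n (replicate n R) (length-replicate n))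
  ◅◅ carry n ◅ gmap (R ∷_) keep (firstOfLevel⋖⋆ n w (ℕ.suc-injective e))

Listed : String → Set
Listed w = ∃[ i ] levelOrder i ≡ w

listed-⋖⋆ : ∀ {v w} → Star _⋖_ v w → Listed v → Listed w
listed-⋖⋆ ε            listed     = listed
listed-⋖⋆ (u⋖v ◅ v⋖⋆w) (i , refl) = listed-⋖⋆ v⋖⋆w (suc i , cong target (view-⋖ u⋖v))

-- The previous level is traversed from its first string to its last, whose successor opens the next
-- level.
listed-first : ∀ n → Listed (replicate n L)
listed-first zero    = 0 , refl
listed-first (suc n)
  with listed-⋖⋆ (firstOfLevel⋖⋆ n (replicate n R) (length-replicate n)) (listed-first n)
... | i , e = suc i , trans (cong successor e) (cong target (view-last n))

levelOrder-surjective : StrictlySurjective _≡_ levelOrder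
levelOrder-surjective w =
  listed-⋖⋆ (firstOfLevel⋖⋆ (length w) w refl) (listed-first (length w))

levelOrder-isLevelOrderList : IsLevelOrderList levelOrder
levelOrder-isLevelOrderList = record
  { increasing = levelOrder-increasing
  ; exhaustive = levelOrder-surjective
  }

increasing⇒injective : ∀ {s} → (∀ {i j} → i ℕ.< j → s i <ˡᵉᵛ s j) → Injective _≡_ _≡_ s
increasing⇒injective {s} inc {i} {j} e with ℕ.<-cmp i j
... | tri< i<j _ _ = contradiction (subst (s i <ˡᵉᵛ_) (sym e) (inc i<j)) <ˡᵉᵛ-irrefl
... | tri≈ _ i≡j _ = i≡j
... | tri> _ _ j<i = contradiction (subst (_<ˡᵉᵛ s i) (sym e) (inc j<i)) <ˡᵉᵛ-irrefl

-- Matrices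

mat-cong : ∀ {a a′ b b′ c c′ d d′} → a ≡ a′ → b ≡ b′ → c ≡ c′ → d ≡ d′ →
           mat a b c d ≡ mat a′ b′ c′ d′
mat-cong refl refl refl refl = refl

-- The scalar identity u(Mv) = (uM)v, from which all three associativity laws follow entry by entry.
dot-assoc : ∀ x y a b c d z w →
            x * (a * z + b * w) + y * (c * z + d * w) ≡ (x * a + y * c) * z + (x * b + y * d) * w
dot-assoc = solve-∀

⊗-assoc : ∀ A B C → (A ⊗ B) ⊗ C ≡ A ⊗ (B ⊗ C)
⊗-assoc (mat a b c d) (mat a′ b′ c′ d′) (mat a″ b″ c″ d″) = mat-cong
  (sym (dot-assoc a b a′ b′ c′ d′ a″ c″)) (sym (dot-assoc a b a′ b′ c′ d′ b″ d″))
  (sym (dot-assoc c d a′ b′ c′ d′ a″ c″)) (sym (dot-assoc c d a′ b′ c′ d′ b″ d″))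

⊗-⊗ᶜ-assoc : ∀ A B v → (A ⊗ B) ⊗ᶜ v ≡ A ⊗ᶜ (B ⊗ᶜ v)
⊗-⊗ᶜ-assoc (mat a b c d) (mat a′ b′ c′ d′) (vec x y) =
  sym (cong₂ vec (dot-assoc a b a′ b′ c′ d′ x y) (dot-assoc c d a′ b′ c′ d′ x y))

ʳ⊗-⊗-assoc : ∀ v A B → v ʳ⊗ (A ⊗ B) ≡ (v ʳ⊗ A) ʳ⊗ B
ʳ⊗-⊗-assoc (vec x y) (mat a b c d) (mat a′ b′ c′ d′) =
  cong₂ vec (dot-assoc x y a b c d a′ c′) (dot-assoc x y a b c d b′ d′)

1x+0y≡x : ∀ x y → 1ℤ * x + 0ℤ * y ≡ x
1x+0y≡x = solve-∀

0x+1y≡y : ∀ x y → 0ℤ * x + 1ℤ * y ≡ y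
0x+1y≡y = solve-∀

1x+1y≡x+y : ∀ x y → 1ℤ * x + 1ℤ * y ≡ x + y
1x+1y≡x+y = solve-∀

x1+y0≡x : ∀ x y → x * 1ℤ + y * 0ℤ ≡ x
x1+y0≡x = solve-∀

x0+y1≡y : ∀ x y → x * 0ℤ + y * 1ℤ ≡ y
x0+y1≡y = solve-∀

x1+y1≡x+y : ∀ x y → x * 1ℤ + y * 1ℤ ≡ x + y
x1+y1≡x+y = solve-∀

𝐋-⊗ᶜ : ∀ x y → 𝐋 ⊗ᶜ vec x y ≡ vec x (x + y)
𝐋-⊗ᶜ x y = cong₂ vec (1x+0y≡x x y) (1x+1y≡x+y x y)

𝐑-⊗ᶜ : ∀ x y → 𝐑 ⊗ᶜ vec x y ≡ vec (x + y) y
𝐑-⊗ᶜ x y = cong₂ vec (1x+1y≡x+y x y) (0x+1y≡y x y)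

ʳ⊗-𝐋 : ∀ x y → vec x y ʳ⊗ 𝐋 ≡ vec (x + y) y
ʳ⊗-𝐋 x y = cong₂ vec (x1+y1≡x+y x y) (x0+y1≡y x y)

ʳ⊗-𝐑 : ∀ x y → vec x y ʳ⊗ 𝐑 ≡ vec x (x + y)
ʳ⊗-𝐑 x y = cong₂ vec (x1+y0≡x x y) (x1+y1≡x+y x y)

⊗-identityˡ : ∀ A → 𝐈 ⊗ A ≡ A
⊗-identityˡ (mat a b c d) = mat-cong (1x+0y≡x a c) (1x+0y≡x b d) (0x+1y≡y a c) (0x+1y≡y b d)

μ-++ : ∀ v w → μ (v ++ w) ≡ μ v ⊗ μ w
μ-++ []      w = sym (⊗-identityˡ (μ w))
μ-++ (a ∷ v) w = trans (cong (generator a ⊗_) (μ-++ v w)) (sym (⊗-assoc (generator a) (μ v) (μ w)))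

μ-replicate-R : ∀ n → μ (replicate n R) ≡ mat 1ℤ (+ n) 0ℤ 1ℤ
μ-replicate-R zero    = refl
μ-replicate-R (suc n) rewrite μ-replicate-R n =
  mat-cong refl (trans (1x+1y≡x+y (+ n) 1ℤ) (ℤ.+-comm (+ n) 1ℤ)) refl (0x+1y≡y (+ n) 1ℤ)

μ-replicate-L : ∀ n → μ (replicate n L) ≡ mat 1ℤ 0ℤ (+ n) 1ℤ
μ-replicate-L zero    = refl
μ-replicate-L (suc n) rewrite μ-replicate-L n =
  mat-cong (1x+0y≡x 1ℤ (+ n)) refl (1x+1y≡x+y 1ℤ (+ n)) refl

-- The recursion

multiplier : ℕ → Matrix
multiplier k = mat (+ 2 * + k + 1ℤ) 1ℤ -1ℤ 0ℤ

carryLength : ∀ {v w} → v ⋖ w → ℕ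
carryLength (carry n)  = n
carryLength (keep v⋖w) = carryLength v⋖w

carry-multiplier : ∀ n → μ (R ∷ replicate n L) ≡ μ (L ∷ replicate n R) ⊗ multiplier n
carry-multiplier n rewrite μ-replicate-L n | μ-replicate-R n =
  mat-cong (e₀₀ (+ n)) (e₀₁ (+ n)) (e₁₀ (+ n)) (e₁₁ (+ n))
  where
  e₀₀ : ∀ z → 1ℤ * 1ℤ + 1ℤ * z ≡
        (1ℤ * 1ℤ + 0ℤ * 0ℤ) * (+ 2 * z + 1ℤ) + (1ℤ * z + 0ℤ * 1ℤ) * -1ℤ
  e₀₀ = solve-∀
  e₀₁ : ∀ z → 1ℤ * 0ℤ + 1ℤ * 1ℤ ≡
        (1ℤ * 1ℤ + 0ℤ * 0ℤ) * 1ℤ + (1ℤ * z + 0ℤ * 1ℤ) * 0ℤ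
  e₀₁ = solve-∀
  e₁₀ : ∀ z → 0ℤ * 1ℤ + 1ℤ * z ≡
        (1ℤ * 1ℤ + 1ℤ * 0ℤ) * (+ 2 * z + 1ℤ) + (1ℤ * z + 1ℤ * 1ℤ) * -1ℤ
  e₁₀ = solve-∀
  e₁₁ : ∀ z → 0ℤ * 0ℤ + 1ℤ * 1ℤ ≡
        (1ℤ * 1ℤ + 1ℤ * 0ℤ) * 1ℤ + (1ℤ * z + 1ℤ * 1ℤ) * 0ℤ
  e₁₁ = solve-∀

-- The common prefix multiplies on the left and the multiplier on the right, so associativity
-- reduces the claim to a bare carry.
⋖-multiplier : ∀ {v w} (v⋖w : v ⋖ w) → μ w ≡ μ v ⊗ multiplier (carryLength v⋖w)
⋖-multiplier (carry n) = carry-multiplier n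
⋖-multiplier (keep {a} {v} v⋖w) =
  trans (cong (generator a ⊗_) (⋖-multiplier v⋖w))
        (sym (⊗-assoc (generator a) (μ v) (multiplier (carryLength v⋖w))))

-- x is at least 2, so that the recursion takes its second branch, and ⌊(y − 1) / x⌋ = k.
record HasQuotient (k : ℕ) (u : Vec₂) : Set where
  constructor hasQuotient
  field
    c r : ℕ
    x≡  : Vec₂.x u ≡ + suc (suc c)
    y≡  : Vec₂.y u ≡ + suc (r ℕ.+ k ℕ.* suc (suc c))
    r<  : r ℕ.< suc (suc c)

-- The row vector is an arbitrary positive one, not just `𝟏`, because the induction absorbs each
-- prefix letter into it; positivity survives.
⋖-hasQuotient : ∀ {v w} (v⋖w : v ⋖ w) p q →
                HasQuotient (carryLength v⋖w) (vec (+ suc p) (+ suc q) ʳ⊗ μ v)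
-- With x = p+1 and y = q+1, the row becomes (x+y, y+n(x+y)); subtracting 1 from the second entry
-- leaves remainder q, below x+y = p+q+2.
⋖-hasQuotient (carry n) p q rewrite μ-replicate-R n = hasQuotient (p ℕ.+ q) q
  (trans (e₀ (+ suc p) (+ suc q)) (cong (λ z → + suc z) (ℕ.+-suc p q)))
  (trans (e₁ (+ suc p) (+ suc q) (+ n))
    (cong (λ z → + suc q + z)
      (trans (cong (λ z → + n * (+ suc z)) (ℕ.+-suc p q)) (sym (ℤ.pos-* n _)))))
  (s≤s (ℕ.m≤n⇒m≤1+n (ℕ.m≤n+m q p)))
  where
  e₀ : ∀ x y → x * (1ℤ * 1ℤ + 0ℤ * 0ℤ) + y * (1ℤ * 1ℤ + 1ℤ * 0ℤ) ≡ x + y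
  e₀ = solve-∀
  e₁ : ∀ x y z → x * (1ℤ * z + 0ℤ * 1ℤ) + y * (1ℤ * z + 1ℤ * 1ℤ) ≡ y + z * (x + y)
  e₁ = solve-∀
⋖-hasQuotient (keep {L} {v} v⋖w) p q =
  subst (HasQuotient (carryLength v⋖w))
    (trans (cong (_ʳ⊗ μ v) (sym (ʳ⊗-𝐋 (+ suc p) (+ suc q))))
           (sym (ʳ⊗-⊗-assoc (vec (+ suc p) (+ suc q)) 𝐋 (μ v))))
    (⋖-hasQuotient v⋖w (p ℕ.+ suc q) q)
⋖-hasQuotient (keep {R} {v} v⋖w) p q =
  subst (HasQuotient (carryLength v⋖w))
    (trans (cong (_ʳ⊗ μ v) (sym (ʳ⊗-𝐑 (+ suc p) (+ suc q))))
           (sym (ʳ⊗-⊗-assoc (vec (+ suc p) (+ suc q)) 𝐑 (μ v))))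
    (⋖-hasQuotient v⋖w p (p ℕ.+ suc q))

-- Floors of fractions

floor-mkℚ+ : ∀ n d .{{_ : NonZero d}} .(c : Coprime n d) → floor (mkℚ+ n d c) ≡ + (n ℕ./ d)
floor-mkℚ+ n (suc d) c = ℤ.*-identityˡ _

-- The rational is stored in lowest terms, and cancelling the gcd does not change the quotient of
-- natural division.
floor-/ : ∀ m d .{{_ : NonZero d}} → floor (+ m ℚ./ d) ≡ + (m ℕ./ d)
floor-/ m d = trans (floor-mkℚ+ (m ℕ./ g) (d ℕ./ g) (Coprimality.coprime-/gcd m d)) (cong +_ (begin
  (m ℕ./ g) ℕ./ (d ℕ./ g)                     ≡⟨ m*n/m*o≡n/o g (m ℕ./ g) (d ℕ./ g) ⟨
  (g ℕ.* (m ℕ./ g)) ℕ./ (g ℕ.* (d ℕ./ g))     ≡⟨ /-congˡ {o = g ℕ.* (d ℕ./ g)} (m*[n/m]≡n (gcd[m,n]∣m m d)) ⟩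
  m ℕ./ (g ℕ.* (d ℕ./ g))                     ≡⟨ /-congʳ (m*[n/m]≡n (gcd[m,n]∣n m d)) ⟩
  m ℕ./ d                                     ∎))
  where
  open ≡-Reasoning
  g = gcd m d
  instance
    g≢0 : NonZero g
    g≢0 = ℕ.≢-nonZero (gcd[m,n]≢0 m d (inj₂ (ℕ.≢-nonZero⁻¹ d)))
    d/g≢0 : NonZero (d ℕ./ g)
    d/g≢0 = ℕ.≢-nonZero (n/gcd[m,n]≢0 m d)
    g*d/g≢0 : NonZero (g ℕ.* (d ℕ./ g))
    g*d/g≢0 = ℕ.m*n≢0 g (d ℕ./ g)

[r+kd]/d≡k : ∀ {r} k d .{{_ : NonZero d}} → r ℕ.< d → (r ℕ.+ k ℕ.* d) ℕ./ d ≡ k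
[r+kd]/d≡k {r} k d r<d = begin
  (r ℕ.+ k ℕ.* d) ℕ./ d          ≡⟨ +-distrib-/-∣ʳ r (divides-refl k) ⟩
  r ℕ./ d ℕ.+ k ℕ.* d ℕ./ d      ≡⟨ cong₂ ℕ._+_ (m<n⇒m/n≡0 r<d) (m*n/n≡m k d) ⟩
  k                              ∎
  where open ≡-Reasoning

next-hasQuotient : ∀ D k → HasQuotient k (𝟏 ʳ⊗ D) → next D ≡ just (D ⊗ multiplier k)
next-hasQuotient (mat a b c d) k (hasQuotient C r x≡ y≡ r<)
  -- Once the sums are visible successors, the test against 1 evaluates to false and the subtraction
  -- of 1 evaluates to a natural dividend.
  rewrite trans (sym (1x+1y≡x+y a c)) x≡ | trans (sym (1x+1y≡x+y b d)) y≡ =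
  cong (λ j → just (mat a b c d ⊗ mat (+ 2 * j + 1ℤ) 1ℤ -1ℤ 0ℤ))
    (trans (floor-/ (r ℕ.+ k ℕ.* suc (suc C)) (suc (suc C)))
           (cong +_ ([r+kd]/d≡k k (suc (suc C)) r<)))

next-μ : ∀ v → next (μ v) ≡ just (μ (successor v))
next-μ v with view v
... | sameLevel v⋖w = trans (next-hasQuotient (μ v) (carryLength v⋖w) (⋖-hasQuotient v⋖w 0 0))
                            (cong just (sym (⋖-multiplier v⋖w)))
-- Here `μ v` has rows (1 n) and (0 1): the first branch applies, with lower left entry n+1.
... | lastOfLevel n rewrite μ-replicate-R n | μ-replicate-L n =
  cong just (mat-cong (sym (1x+0y≡x 1ℤ (+ n))) refl
    (trans (ℤ.+-comm (+ n) 1ℤ) (sym (1x+1y≡x+y 1ℤ (+ n)))) refl)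

matrixSeq≡μ : ∀ i → matrixSeq i ≡ just (μ (levelOrder i))
matrixSeq≡μ zero    = refl
matrixSeq≡μ (suc i) = trans (cong (_>>= next) (matrixSeq≡μ i)) (next-μ (levelOrder i))

-- Fractions

num den : String → ℕ
num []      = 1
num (L ∷ w) = num w
num (R ∷ w) = num w ℕ.+ den w
den []      = 1
den (L ∷ w) = num w ℕ.+ den w
den (R ∷ w) = den w

num>0 : ∀ w → 0 ℕ.< num w
num>0 []      = z<s
num>0 (L ∷ w) = num>0 w
num>0 (R ∷ w) = ℕ.<-≤-trans (num>0 w) (ℕ.m≤m+n (num w) (den w))

den>0 : ∀ w → 0 ℕ.< den w
den>0 []      = z<s
den>0 (L ∷ w) = ℕ.<-≤-trans (den>0 w) (ℕ.m≤n+m (den w) (num w))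
den>0 (R ∷ w) = den>0 w

num-den-coprime : ∀ w → Coprime (num w) (den w)
num-den-coprime []      = 1-coprimeTo 1
num-den-coprime (L ∷ w) = Coprimality.sym (coprime-+ (Coprimality.sym (num-den-coprime w)))
num-den-coprime (R ∷ w) =
  subst (λ n → Coprime n (den w)) (ℕ.+-comm (den w) (num w)) (coprime-+ (num-den-coprime w))

μ-⊗ᶜ-𝟏 : ∀ w → μ w ⊗ᶜ 𝟏 ≡ vec (+ num w) (+ den w)
μ-⊗ᶜ-𝟏 []      = refl
μ-⊗ᶜ-𝟏 (L ∷ w) = trans (⊗-⊗ᶜ-assoc 𝐋 (μ w) 𝟏)
  (trans (cong (𝐋 ⊗ᶜ_) (μ-⊗ᶜ-𝟏 w)) (𝐋-⊗ᶜ (+ num w) (+ den w)))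
μ-⊗ᶜ-𝟏 (R ∷ w) = trans (⊗-⊗ᶜ-assoc 𝐑 (μ w) 𝟏)
  (trans (cong (𝐑 ⊗ᶜ_) (μ-⊗ᶜ-𝟏 w)) (𝐑-⊗ᶜ (+ num w) (+ den w)))

private
  m≢m+n : ∀ {m n} → 0 ℕ.< n → m ≢ m ℕ.+ n
  m≢m+n {m} n>0 = ℕ.<⇒≢ (ℕ.m<m+n m n>0)

  n≢m+n : ∀ {m n} → 0 ℕ.< m → n ≢ m ℕ.+ n
  n≢m+n {m} {n} m>0 e = m≢m+n m>0 (trans e (ℕ.+-comm m n))

  -- Equality of both coordinates would give m < n′ < m.
  L≢R : ∀ {m n m′ n′} → 0 ℕ.< n → 0 ℕ.< m′ → m ≡ m′ ℕ.+ n′ → m ℕ.+ n ≢ n′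
  L≢R {m} {n} {m′} {n′} n>0 m′>0 e f = ℕ.<-asym
    (subst (m ℕ.<_) f (ℕ.m<m+n m n>0)) (subst (n′ ℕ.<_) (sym e) (ℕ.m<n+m n′ m′>0))

-- Comparing numerator with denominator reveals the first letter: smaller for L, larger for R, equal
-- only at the root. Cancellation then passes to the tails.
num-den-injective : ∀ v w → num v ≡ num w → den v ≡ den w → v ≡ w
num-den-injective []      []      _ _ = refl
num-den-injective []      (L ∷ w) e f = contradiction (trans (sym e) f) (m≢m+n (den>0 w))
num-den-injective []      (R ∷ w) e f = contradiction (trans (sym f) e) (n≢m+n (num>0 w))
num-den-injective (L ∷ v) []      e f = contradiction (trans e (sym f)) (m≢m+n (den>0 v))
num-den-injective (R ∷ v) []      e f = contradiction (trans f (sym e)) (n≢m+n (num>0 v))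
num-den-injective (L ∷ v) (R ∷ w) e f = contradiction f (L≢R (den>0 v) (num>0 w) e)
num-den-injective (R ∷ v) (L ∷ w) e f = contradiction (sym f) (L≢R (den>0 w) (num>0 v) (sym e))
num-den-injective (L ∷ v) (L ∷ w) e f = cong (L ∷_)
  (num-den-injective v w e (ℕ.+-cancelˡ-≡ (num w) _ _ (trans (cong (ℕ._+ den v) (sym e)) f)))
num-den-injective (R ∷ v) (R ∷ w) e f = cong (R ∷_)
  (num-den-injective v w (ℕ.+-cancelʳ-≡ (den w) _ _ (trans (cong (num v ℕ.+_) (sym f)) e)) f)

coprime-+⁻ : ∀ {m n} → Coprime m (m ℕ.+ n) → Coprime m n
coprime-+⁻ c (i∣m , i∣n) = c (i∣m , ∣m∣n⇒∣m+n i∣m i∣n)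

num-den-surjective : ∀ n d → 0 ℕ.< n → 0 ℕ.< d → Coprime n d →
                     ∃[ w ] num w ≡ n × den w ≡ d
num-den-surjective n d n>0 d>0 c = euclid n d n>0 d>0 c (<-wellFounded (n ℕ.+ d))
  where
  euclid : ∀ n d → 0 ℕ.< n → 0 ℕ.< d → Coprime n d → Acc ℕ._<_ (n ℕ.+ d) →
           ∃[ w ] num w ≡ n × den w ≡ d
  euclid n d n>0 d>0 c (acc rec) with ℕ.compare n d
  -- The common value divides both numbers, so coprimality makes it 1.
  ... | ℕ.equal _ with refl ← c (∣-refl , ∣-refl) = [] , refl , refl
  -- Here d = n+k+1; subtracting n leaves the positive k+1, and the letter L adds n back.
  ... | ℕ.less _ k
    with euclid n (suc k) n>0 z<s (coprime-+⁻ (subst (Coprime n) (sym (ℕ.+-suc n k)) c))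
           (rec (ℕ.+-monoʳ-< n (s≤s (ℕ.m<n+m k n>0))))
  ...   | w , refl , e = L ∷ w , refl , trans (cong (n ℕ.+_) e) (ℕ.+-suc n k)
  euclid n d n>0 d>0 c (acc rec) | ℕ.greater _ k
    with euclid (suc k) d z<s d>0
           (Coprimality.sym (coprime-+⁻ (subst (Coprime d) (sym (ℕ.+-suc d k)) (Coprimality.sym c))))
           (rec (ℕ.+-monoˡ-< d (s≤s (ℕ.m<n+m k d>0))))
  ...   | w , e , refl = R ∷ w , trans (cong (ℕ._+ d) e) (cong suc (ℕ.+-comm k d)) , refl

fraction : String → ℚ
fraction w = (+ num w ℚ./ den w) {{ℕ.>-nonZero (den>0 w)}}

÷-pos : ∀ n d .{{_ : NonZero d}} → n ÷ (+ d) ≡ just (n ℚ./ d)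
÷-pos n (suc d) = refl

-- Normalisation fixes a coprime pair, so the rational determines the pair; this transfers
-- injectivity from pairs to `fraction`.
coprime⇒↥↧ : ∀ n d .{{_ : NonZero d}} → Coprime n d →
             ↥ (+ n ℚ./ d) ≡ + n × ↧ₙ (+ n ℚ./ d) ≡ d
coprime⇒↥↧ n (suc d) c = cong ↥_ (ℚ.normalize-coprime c) , cong ↧ₙ_ (ℚ.normalize-coprime c)

fraction-↥↧ : ∀ w → ↥ (fraction w) ≡ + num w × ↧ₙ (fraction w) ≡ den w
fraction-↥↧ w = coprime⇒↥↧ (num w) (den w) {{ℕ.>-nonZero (den>0 w)}} (num-den-coprime w)

fraction-positive : ∀ w → 0ℚ ℚ.< fraction w
fraction-positive w = ℚ.positive⁻¹ (fraction w)
  {{ℚ.normalize-pos (num w) (den w) {{ℕ.>-nonZero (den>0 w)}} {{ℕ.>-nonZero (num>0 w)}}}}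

fraction-injective : Injective _≡_ _≡_ fraction
fraction-injective {v} {w} e with fraction-↥↧ v | fraction-↥↧ w
... | v↥ , v↧ | w↥ , w↧ = num-den-injective v w
  (ℤ.+-injective (trans (sym v↥) (trans (cong ↥_ e) w↥)))
  (trans (sym v↧) (trans (cong ↧ₙ_ e) w↧))

fraction-surjective : ∀ x → 0ℚ ℚ.< x → ∃[ w ] fraction w ≡ x
fraction-surjective x x>0 with x | ℚ.positive x>0
... | mkℚ (+ suc n) d c | _
  with num-den-surjective (suc n) (suc d) z<s z<s (Coprimality.recompute c)
...   | w , n≡ , d≡ = w , trans
  (ℚ./-cong {{ℕ.>-nonZero (den>0 w)}} (cong +_ n≡) d≡) (ℚ.normalize-coprime c)

-- Serves both trees: `s` gives the nodes visited in `t`, while `σ` gives the strings whose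
-- Stern-Brocot fractions are the values found there.
enumerates : ∀ {s t} (σ : ℕ → String) → Injective _≡_ _≡_ σ → StrictlySurjective _≡_ σ →
             (V : ℕ → Vec₂) → (∀ i → V i ≡ μ (σ i) ⊗ᶜ 𝟏) →
             (∀ i → t (s i) ≡ Vec₂.x (V i) ÷ Vec₂.y (V i)) →
             EnumeratesPositiveRationals s t (λ i → Vec₂.x (V i)) (λ i → Vec₂.y (V i))
enumerates σ σ-inj σ-surj V V≡μ t≡ = record
  { value       = λ i → fraction (σ i)
  ; isQuotient  = isQuotient
  ; den-pos     = λ i → subst (λ u → 0ℤ < Vec₂.y u) (sym (V≡ i)) (+<+ (den>0 (σ i)))
  ; coprime     = λ i → subst (λ u → ℤCoprimality.Coprime (Vec₂.x u) (Vec₂.y u)) (sym (V≡ i))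
                          (num-den-coprime (σ i))
  ; positive    = λ i → fraction-positive (σ i)
  ; exactlyOnce = exactlyOnce
  ; treeOrder   = λ i → trans (t≡ i) (isQuotient i)
  }
  where
  V≡ : ∀ i → V i ≡ vec (+ num (σ i)) (+ den (σ i))
  V≡ i = trans (V≡μ i) (μ-⊗ᶜ-𝟏 (σ i))

  isQuotient : ∀ i → Vec₂.x (V i) ÷ Vec₂.y (V i) ≡ just (fraction (σ i))
  isQuotient i = trans (cong (λ u → Vec₂.x u ÷ Vec₂.y u) (V≡ i))
    (÷-pos (+ num (σ i)) (den (σ i)) {{ℕ.>-nonZero (den>0 (σ i))}})

  exactlyOnce : ∀ x → 0ℚ ℚ.< x → ∃! _≡_ (λ i → fraction (σ i) ≡ x)
  exactlyOnce x x>0 with fraction-surjective x x>0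
  ... | w , refl with σ-surj w
  ...   | i , refl = i , refl , λ e → σ-inj (fraction-injective (sym e))

-- Reversal of strings, relating the two trees

swap : Vec₂ → Vec₂
swap (vec x y) = vec y x

-- The exchange of coordinates conjugates L into R, which is the transpose of L.
swap-ʳ⊗-generator : ∀ u a → swap (u ʳ⊗ generator a) ≡ generator a ⊗ᶜ swap u
swap-ʳ⊗-generator (vec x y) L = trans (cong swap (ʳ⊗-𝐋 x y))
  (trans (cong (vec y) (ℤ.+-comm x y)) (sym (𝐋-⊗ᶜ y x)))
swap-ʳ⊗-generator (vec x y) R = trans (cong swap (ʳ⊗-𝐑 x y))
  (trans (cong (λ z → vec z x) (ℤ.+-comm x y)) (sym (𝐑-⊗ᶜ y x)))

-- A row meets the first letter of the string first, a column the last one; hence the reversal. The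
-- vector `u` is general because it absorbs the first letter.
swap-ʳ⊗-μ : ∀ u w → swap (u ʳ⊗ μ w) ≡ μ (reverse w) ⊗ᶜ swap u
swap-ʳ⊗-μ (vec x y) [] = cong₂ vec
  (trans (x0+y1≡y x y) (sym (1x+0y≡x y x))) (trans (x1+y0≡x x y) (sym (0x+1y≡y y x)))
swap-ʳ⊗-μ u (a ∷ w) = begin
  swap (u ʳ⊗ (generator a ⊗ μ w))                  ≡⟨ cong swap (ʳ⊗-⊗-assoc u (generator a) (μ w)) ⟩
  swap ((u ʳ⊗ generator a) ʳ⊗ μ w)                 ≡⟨ swap-ʳ⊗-μ (u ʳ⊗ generator a) w ⟩
  μ (reverse w) ⊗ᶜ swap (u ʳ⊗ generator a)         ≡⟨ cong (μ (reverse w) ⊗ᶜ_) (swap-ʳ⊗-generator u a) ⟩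
  μ (reverse w) ⊗ᶜ (generator a ⊗ᶜ swap u)         ≡⟨ ⊗-⊗ᶜ-assoc (μ (reverse w)) (generator a) (swap u) ⟨
  (μ (reverse w) ⊗ generator a) ⊗ᶜ swap u          ≡⟨ cong (_⊗ᶜ swap u) μ-reverse-∷ ⟨
  μ (reverse (a ∷ w)) ⊗ᶜ swap u                    ∎
  where
  open ≡-Reasoning
  generator-⊗-𝐈 : ∀ a → generator a ⊗ 𝐈 ≡ generator a
  generator-⊗-𝐈 L = refl
  generator-⊗-𝐈 R = refl
  μ-reverse-∷ : μ (reverse (a ∷ w)) ≡ μ (reverse w) ⊗ generator a
  μ-reverse-∷ = trans (cong μ (unfold-reverse a w))
    (trans (μ-++ (reverse w) (a ∷ [])) (cong (μ (reverse w) ⊗_) (generator-⊗-𝐈 a)))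

mainTheorem4 : Σ[ D ∈ (ℕ → Matrix) ] Σ[ s ∈ (ℕ → String) ]
    ( (∀ i → matrixSeq i ≡ just (D i))
    × IsLevelOrderList s
    × (∀ i → D i ≡ treeOfProducts (s i))
    × EnumeratesPositiveRationals s sternBrocot
    (λ i → Vec₂.x (D i ⊗ᶜ 𝟏)) (λ i → Vec₂.y (D i ⊗ᶜ 𝟏))
    × EnumeratesPositiveRationals s eisensteinStern
    (λ i → Vec₂.y (𝟏 ʳ⊗ D i)) (λ i → Vec₂.x (𝟏 ʳ⊗ D i)) )
mainTheorem4 =
    (λ i → μ (levelOrder i)) , levelOrder , matrixSeq≡μ , levelOrder-isLevelOrderList , (λ _ → refl)
  , enumerates levelOrder levelOrder-injective levelOrder-surjective
      (λ i → μ (levelOrder i) ⊗ᶜ 𝟏) (λ _ → refl) (λ _ → refl)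
  -- Reversal is a bijection on strings, so exactness survives, while the nodes are still visited in
  -- `levelOrder`.
  , enumerates (λ i → reverse (levelOrder i))
      (λ e → levelOrder-injective (reverse-injective e)) reverse∘levelOrder-surjective
      (λ i → swap (𝟏 ʳ⊗ μ (levelOrder i))) (λ i → swap-ʳ⊗-μ 𝟏 (levelOrder i)) (λ _ → refl)
  where
  levelOrder-injective : Injective _≡_ _≡_ levelOrder
  levelOrder-injective = increasing⇒injective levelOrder-increasing

  reverse∘levelOrder-surjective : StrictlySurjective _≡_ (λ i → reverse (levelOrder i))
  reverse∘levelOrder-surjective w with levelOrder-surjective (reverse w)
  ... | i , e = i , trans (cong reverse e) (reverse-involutive w)
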